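{- Let $\mathcal{A}\subseteq\mathrm{Fm}_m$ and suppose that there is $n_0\in\mathbb{N}$ such that for every $n\ge n_0$ there exist $m\in\mathbb{N}^+$ and $k\in\mathbb{N}$ with $\vdash_{\mathsf{MLL}_0\oplus\mathcal{A}}(np)^k\to m(p^n)$, where $p$ is a propositional variable. Then $\mathsf{IUL}^\star\oplus\mathcal{A}$ admits a theorem of alternatives and its multiplicative fragment is $\mathsf{MLL}_0^u\oplus\mathcal{A}$.
   Context: A logic over a propositional language $\mathcal{L}$ is a pair $\langle\mathcal{L},\vdash_{\mathsf{L}}\rangle$ where $\vdash_{\mathsf{L}}\subseteq\mathcal{P}(\mathrm{Fm}_{\mathcal{L}})\times\mathrm{Fm}_{\mathcal{L}}$ is a substitution-invariant consequence relation (reflexive, monotone, closed under cut and under substitutions) on the formulas over a fixed countably infinite set of variables; $\vdash_{\mathsf{L}}\varphi$ means $\emptyset\vdash_{\mathsf{L}}\varphi$. $\mathsf{L}'$ is an extension of $\mathsf{L}$ if $\vdash_{\mathsf{L}}\subseteq\vdash_{\mathsf{L}'}$; for a set $X$ of formulas, $\mathsf{L}\oplus X$ is the smallest extension of $\mathsf{L}$ that includes $X$ (as theorems). The language $\mathcal{L}_m$ has binary connectives $\to,\cdot$ and constants $1,0$; set $\neg\varphi:=\varphi\to 0$, $\varphi+\psi:=\neg\varphi\to\psi$, $0\varphi:=0$, $(n+1)\varphi:=n\varphi+\varphi$, $\varphi^0:=1$, $\varphi^{n+1}:=\varphi^n\cdot\varphi$. Formulas of $\mathcal{L}_m$ are multiplicative;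 their set is $\mathrm{Fm}_m$. $\mathsf{MLL}$ is the logic over $\mathcal{L}_m$ given by the axiom schemas $(\varphi\to\psi)\to((\psi\to\chi)\to(\varphi\to\chi))$, $(\varphi\to(\psi\to\chi))\to(\psi\to(\varphi\to\chi))$, $\varphi\to\varphi$, $\neg\neg\varphi\to\varphi$, $(\varphi\to(\psi\to\chi))\to((\varphi\cdot\psi)\to\chi)$, $\varphi\to(\psi\to(\varphi\cdot\psi))$, $\varphi\to(1\to\varphi)$, $1$, and the rule modus ponens. $\mathsf{MLL}^u$ is $\mathsf{MLL}$ extended with the rules "from $n\varphi$ infer $\varphi$" for each $n\in\mathbb{N}^+$. $\mathsf{MLL}_0:=\mathsf{MLL}\oplus\{0\to1\}$ and $\mathsf{MLL}_0^u:=\mathsf{MLL}^u\oplus\{0\to1\}$. The language $\mathcal{L}_\ell$ extends $\mathcal{L}_m$ with binary $\land,\lor$. $\mathsf{MALL}^-$ is the logic over $\mathcal{L}_\ell$ given by the axioms of $\mathsf{MLL}$ plus $(\varphi\land\psi)\to\varphi$, $(\varphi\land\psi)\to\psi$, $\varphi\to(\varphi\lor\psi)$, $\psi\to(\varphi\lor\psi)$, $((\varphi\to\psi)\land(\varphi\to\chi))\to(\varphi\to(\psi\land\chi))$, $((\varphi\to\chi)\land(\psi\to\chi))\to((\varphi\lor\psi)\to\chi)$, with rules modus ponens and adjunction (from $\varphi,\psi$ infer $\varphi\land\psi$). $\mathsf{IUL}^-:=\mathsf{MALL}^-\oplus\{((p\to q)\land 1)\lor((q\to p)\land 1)\}$ and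 $\mathsf{IUL}^\star:=\mathsf{IUL}^-\oplus\{p\lor\neg p,\ 0\to1\}$. The multiplicative fragment of an extension $\mathsf{L}$ of $\mathsf{MALL}^-$ is the logic over $\mathcal{L}_m$ with consequence relation $\vdash_{\mathsf{L}}\cap(\mathcal{P}(\mathrm{Fm}_m)\times\mathrm{Fm}_m)$. An extension $\mathsf{L}$ of $\mathsf{IUL}^-$ admits a theorem of alternatives if for all $\Sigma\cup\{\varphi_1,\dots,\varphi_n\}\subseteq\mathrm{Fm}_m$: $\Sigma\vdash_{\mathsf{L}}\varphi_1\lor\dots\lor\varphi_n$ iff $\Sigma\vdash_{\mathsf{L}}\lambda_1\varphi_1+\dots+\lambda_n\varphi_n$ for some $\lambda_1,\dots,\lambda_n\in\mathbb{N}$ not all $0$. -}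

module Defs where

open import Data.Bool using (Bool; true; false)
open import Data.Nat using (ℕ; zero; suc; _≤_)
open import Data.Fin using (Fin)
open import Data.Vec using (Vec; _∷_; foldl₁; zipWith; lookup; map)
open import Data.Product using (Σ; ∃; _×_; _,_)
open import Relation.Binary.PropositionalEquality using (_≡_; _≢_)
open import Function.Bundles using (_⇔_)

-- Formulas.  Fm false = multiplicative formulas (language L_m),
-- Fm true = formulas of L_ℓ (with ∧, ∨).  Variables are indexed by ℕ.
infixr 5 _⇒_
infixl 7 _·_
infixl 6 _∧_ _∨_

data Fm : Bool → Set where
  var : ∀ {b} → ℕ → Fm b
  _⇒_ : ∀ {b} → Fm b → Fm b → Fm b
  _·_ : ∀ {b} → Fm b → Fm b → Fm b
  𝟙   : ∀ {b} → Fm b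
  𝟘   : ∀ {b} → Fm b
  _∧_ : Fm true → Fm true → Fm true
  _∨_ : Fm true → Fm true → Fm true

FmM : Set
FmM = Fm false

FmL : Set
FmL = Fm true

~_ : ∀ {b} → Fm b → Fm b
~ φ = φ ⇒ 𝟘

_⊞_ : ∀ {b} → Fm b → Fm b → Fm b
φ ⊞ ψ = (~ φ) ⇒ ψ

mul : ∀ {b} → ℕ → Fm b → Fm b
mul zero    φ = 𝟘
mul (suc n) φ = mul n φ ⊞ φ

pow : ∀ {b} → Fm b → ℕ → Fm b
pow φ zero    = 𝟙
pow φ (suc n) = pow φ n · φ

sub : ∀ {b} → (ℕ → Fm b) → Fm b → Fm b
sub σ (var x) = σ x
sub σ (φ ⇒ ψ) = sub σ φ ⇒ sub σ ψ
sub σ (φ · ψ) = sub σ φ · sub σ ψ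
sub σ 𝟙 = 𝟙
sub σ 𝟘 = 𝟘
sub σ (φ ∧ ψ) = sub σ φ ∧ sub σ ψ
sub σ (φ ∨ ψ) = sub σ φ ∨ sub σ ψ

ι : FmM → FmL
ι (var x) = var x
ι (φ ⇒ ψ) = ι φ ⇒ ι ψ
ι (φ · ψ) = ι φ · ι ψ
ι 𝟙 = 𝟙
ι 𝟘 = 𝟘

ιSet : (FmM → Set) → (FmL → Set)
ιSet Γ χ = Σ FmM (λ ψ → Γ ψ × ι ψ ≡ χ)

∅ : ∀ {b} → Fm b → Set
∅ _ = Data.Empty.⊥
  where import Data.Empty

data MLLAx {b : Bool} : Fm b → Set where
  ax-sfx  : ∀ φ ψ χ → MLLAx ((φ ⇒ ψ) ⇒ ((ψ ⇒ χ) ⇒ (φ ⇒ χ)))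
  ax-exch : ∀ φ ψ χ → MLLAx ((φ ⇒ (ψ ⇒ χ)) ⇒ (ψ ⇒ (φ ⇒ χ)))
  ax-id   : ∀ φ → MLLAx (φ ⇒ φ)
  ax-dn   : ∀ φ → MLLAx (~ (~ φ) ⇒ φ)
  ax-res  : ∀ φ ψ χ → MLLAx ((φ ⇒ (ψ ⇒ χ)) ⇒ ((φ · ψ) ⇒ χ))
  ax-fus  : ∀ φ ψ → MLLAx (φ ⇒ (ψ ⇒ (φ · ψ)))
  ax-1i   : ∀ φ → MLLAx (φ ⇒ (𝟙 ⇒ φ))
  ax-1    : MLLAx 𝟙

data LatAx : FmL → Set where
  ax-∧e₁ : ∀ φ ψ → LatAx ((φ ∧ ψ) ⇒ φ)
  ax-∧e₂ : ∀ φ ψ → LatAx ((φ ∧ ψ) ⇒ ψ)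
  ax-∨i₁ : ∀ φ ψ → LatAx (φ ⇒ (φ ∨ ψ))
  ax-∨i₂ : ∀ φ ψ → LatAx (ψ ⇒ (φ ∨ ψ))
  ax-∧i  : ∀ φ ψ χ → LatAx (((φ ⇒ ψ) ∧ (φ ⇒ χ)) ⇒ (φ ⇒ (ψ ∧ χ)))
  ax-∨e  : ∀ φ ψ χ → LatAx (((φ ⇒ χ) ∧ (ψ ⇒ χ)) ⇒ ((φ ∨ ψ) ⇒ χ))

data _⊢MLL₀[_]_ (Γ : FmM → Set) (A : FmM → Set) : FmM → Set where
  hyp  : ∀ {φ} → Γ φ → Γ ⊢MLL₀[ A ] φ
  ax   : ∀ {φ} → MLLAx φ → Γ ⊢MLL₀[ A ] φ
  ax01 : Γ ⊢MLL₀[ A ] (𝟘 ⇒ 𝟙)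
  axA  : ∀ {ψ} → A ψ → (σ : ℕ → FmM) → Γ ⊢MLL₀[ A ] sub σ ψ
  mp   : ∀ {φ ψ} → Γ ⊢MLL₀[ A ] φ → Γ ⊢MLL₀[ A ] (φ ⇒ ψ) → Γ ⊢MLL₀[ A ] ψ

data _⊢MLL₀ᵘ[_]_ (Γ : FmM → Set) (A : FmM → Set) : FmM → Set where
  hyp  : ∀ {φ} → Γ φ → Γ ⊢MLL₀ᵘ[ A ] φ
  ax   : ∀ {φ} → MLLAx φ → Γ ⊢MLL₀ᵘ[ A ] φ
  ax01 : Γ ⊢MLL₀ᵘ[ A ] (𝟘 ⇒ 𝟙)
  axA  : ∀ {ψ} → A ψ → (σ : ℕ → FmM) → Γ ⊢MLL₀ᵘ[ A ] sub σ ψ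
  mp   : ∀ {φ ψ} → Γ ⊢MLL₀ᵘ[ A ] φ → Γ ⊢MLL₀ᵘ[ A ] (φ ⇒ ψ) → Γ ⊢MLL₀ᵘ[ A ] ψ
  urule : ∀ (n : ℕ) {φ} → Γ ⊢MLL₀ᵘ[ A ] mul (suc n) φ → Γ ⊢MLL₀ᵘ[ A ] φ

data _⊢IUL⋆[_]_ (Γ : FmL → Set) (A : FmM → Set) : FmL → Set where
  hyp     : ∀ {φ} → Γ φ → Γ ⊢IUL⋆[ A ] φ
  ax      : ∀ {φ} → MLLAx φ → Γ ⊢IUL⋆[ A ] φ
  axL     : ∀ {φ} → LatAx φ → Γ ⊢IUL⋆[ A ] φ
  prelin  : ∀ φ ψ → Γ ⊢IUL⋆[ A ] (((φ ⇒ ψ) ∧ 𝟙) ∨ ((ψ ⇒ φ) ∧ 𝟙))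
  exmid   : ∀ φ → Γ ⊢IUL⋆[ A ] (φ ∨ ~ φ)
  ax01    : Γ ⊢IUL⋆[ A ] (𝟘 ⇒ 𝟙)
  axA     : ∀ {ψ} → A ψ → (σ : ℕ → FmL) → Γ ⊢IUL⋆[ A ] sub σ (ι ψ)
  mp      : ∀ {φ ψ} → Γ ⊢IUL⋆[ A ] φ → Γ ⊢IUL⋆[ A ] (φ ⇒ ψ) → Γ ⊢IUL⋆[ A ] ψ
  adj     : ∀ {φ ψ} → Γ ⊢IUL⋆[ A ] φ → Γ ⊢IUL⋆[ A ] ψ → Γ ⊢IUL⋆[ A ] (φ ∧ ψ)

bigOr : ∀ {n} → Vec FmL (suc n) → FmL
bigOr = foldl₁ _∨_

linComb : ∀ {n} → Vec ℕ (suc n) → Vec FmM (suc n) → FmM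
linComb λs φs = foldl₁ _⊞_ (zipWith mul λs φs)

TheoremOfAlternatives : (FmM → Set) → Set₁
TheoremOfAlternatives A =
  ∀ (Σ' : FmM → Set) (n : ℕ) (φs : Vec FmM (suc n)) →
    (ιSet Σ' ⊢IUL⋆[ A ] bigOr (map ι φs))
    ⇔ (∃ λ (λs : Vec ℕ (suc n)) →
          (∃ λ (i : Fin (suc n)) → lookup λs i ≢ 0)
          × (ιSet Σ' ⊢IUL⋆[ A ] ι (linComb λs φs)))

MultFragmentIsMLL₀ᵘ : (FmM → Set) → Set₁
MultFragmentIsMLL₀ᵘ A =
  ∀ (Γ : FmM → Set) (φ : FmM) →
    (ιSet Γ ⊢IUL⋆[ A ] ι φ) ⇔ (Γ ⊢MLL₀ᵘ[ A ] φ)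

Hyp : (FmM → Set) → Set
Hyp A = ∃ λ (n₀ : ℕ) → ∀ (n : ℕ) → n₀ ≤ n →
          ∃ λ (m : ℕ) → ∃ λ (k : ℕ) →
            1 ≤ m × (∅ ⊢MLL₀[ A ] (pow (mul n (var 0)) k ⇒ mul m (pow (var 0) n)))

{-# OPTIONS --safe #-}
-- The core is a splitting property of MLL₀ᵘ ⊕ A: if both Γ, ψ and Γ, ~ ψ prove a nontrivial
-- nonnegative combination of the φᵢ, then so does Γ.  It rests on a deduction theorem
-- (Γ, ψ ⊢ χ implies Γ ⊢ ψᵏ ⇒ m χ with m ≥ 1), in which the assumption (n p)ᵏ ⇒ m (pⁿ) is what
-- makes modus ponens go through.  Splitting replaces the prime theories of the usual
-- completeness proof: an IUL⋆ derivation is interpreted over finite binary trees that assume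
-- ψ on one branch and ~ ψ on the other.  On each leaf the finitely many comparisons needed are
-- decided, so lattice formulas take multiplicative values there, and collapsing the tree by
-- splitting yields the combination.  Conversely, prelinearity and excluded middle make
-- "from n φ infer φ" derivable in IUL⋆ for all φ, in particular for φ₁ ∨ … ∨ φₙ.
module Submission where

open import Defs
open import Data.Empty using (⊥-elim)
open import Data.Fin using (zero; suc)
open import Data.List using (List; []; _∷_)
open import Data.List.Membership.Propositional using (_∈_)
open import Data.List.Relation.Binary.Subset.Propositional using (_⊆_)
open import Data.List.Relation.Binary.Subset.Propositional.Properties using (⊆-refl; ⊆-trans; xs⊆x∷xs)
open import Data.List.Relation.Unary.Any using (here; there)
open import Data.Nat using (ℕ; zero; suc; _+_; _*_; _≤_; _<_; _⊔_; _≟_)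
open import Data.Nat.Properties using (+-assoc; +-identityʳ; *-comm; *-assoc; ≤-refl; ≤-trans; n≤1+n; m≤m*n; m≤n*m; m≤m+n; m≤n+m; m⊔n≤o⇒m≤o; m⊔n≤o⇒n≤o; ≤∧≢⇒<; ≤-pred; n≢0⇒n>0; m+n≡0⇒m≡0)
open import Data.Product using (∃; _×_; _,_; proj₁; proj₂)
open import Data.Sum using (_⊎_; inj₁; inj₂)
open import Data.Vec using (Vec; []; _∷_; foldl; zipWith; lookup; map; sum; replicate)
open import Data.Vec.Properties using (lookup-zipWith)
open import Function.Bundles using (mk⇔)
open import Relation.Binary.PropositionalEquality using (_≡_; _≢_; refl; sym; trans; cong; cong₂; subst)
open import Relation.Nullary using (yes; no)

-- Order calculus of a logic above MLL₀, in either language.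

module MLL₀Order {b} (⊢_ : Fm b → Set)
  (ax : ∀ {φ} → MLLAx φ → ⊢ φ) (ax01 : ⊢ (𝟘 ⇒ 𝟙))
  (mp : ∀ {φ ψ} → ⊢ φ → ⊢ (φ ⇒ ψ) → ⊢ ψ) where

  infix 4 _≼_
  infixr 3 _⟫_

  _≼_ : Fm b → Fm b → Set
  x ≼ y = ⊢ (x ⇒ y)

  private variable x y z w : Fm b

  ≼-refl : x ≼ x
  ≼-refl = ax (ax-id _)

  _⟫_ : x ≼ y → y ≼ z → x ≼ z
  p ⟫ q = mp q (mp p (ax (ax-sfx _ _ _)))

  swap : x ≼ y ⇒ z → y ≼ x ⇒ z
  swap p = mp p (ax (ax-exch _ _ _))

  uncurry : x ≼ y ⇒ z → x · y ≼ z
  uncurry p = mp p (ax (ax-res _ _ _))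

  ⇒-monoˡ : x ≼ y → y ⇒ z ≼ x ⇒ z
  ⇒-monoˡ p = mp p (ax (ax-sfx _ _ _))

  ⇒-monoʳ : y ≼ z → x ⇒ y ≼ x ⇒ z
  ⇒-monoʳ p = mp p (swap (ax (ax-sfx _ _ _)))

  pair : x ≼ y ⇒ x · y
  pair = ax (ax-fus _ _)

  curry : x · y ≼ z → x ≼ y ⇒ z
  curry p = pair ⟫ ⇒-monoʳ p

  ⇒-curry : x · y ⇒ z ≼ x ⇒ (y ⇒ z)
  ⇒-curry = swap (pair ⟫ ax (ax-sfx _ _ _))

  ⇒-eval : (x ⇒ y) · x ≼ y
  ⇒-eval = uncurry ≼-refl

  ·-comm : x · y ≼ y · x
  ·-comm = uncurry (swap pair)

  ·-monoˡ : x ≼ y → x · z ≼ y · z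
  ·-monoˡ p = uncurry (p ⟫ pair)

  ·-monoʳ : y ≼ z → x · y ≼ x · z
  ·-monoʳ p = ·-comm ⟫ ·-monoˡ p ⟫ ·-comm

  ·-mono : x ≼ y → z ≼ w → x · z ≼ y · w
  ·-mono p q = ·-monoˡ p ⟫ ·-monoʳ q

  ·-assocʳ : (x · y) · z ≼ x · (y · z)
  ·-assocʳ = uncurry (uncurry (pair ⟫ ⇒-curry))

  ·-assocˡ : x · (y · z) ≼ (x · y) · z
  ·-assocˡ = ·-comm ⟫ ·-assocʳ ⟫ ·-comm ⟫ ·-assocʳ ⟫ ·-comm

  𝟙≼ : ⊢ x → 𝟙 ≼ x
  𝟙≼ p = mp p (ax (ax-1i _))

  ⊢𝟙 : ⊢ 𝟙
  ⊢𝟙 = ax ax-1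

  ·-𝟙ˡ : 𝟙 · x ≼ x
  ·-𝟙ˡ = uncurry (𝟙≼ ≼-refl)

  ~~-intro : x ≼ ~ (~ x)
  ~~-intro = swap ≼-refl

  ~~-elim : ~ (~ x) ≼ x
  ~~-elim = ax (ax-dn _)

  ~𝟘≼𝟙 : ~ 𝟘 ≼ 𝟙
  ~𝟘≼𝟙 = ⇒-monoˡ (mp ⊢𝟙 ~~-intro) ⟫ ~~-elim

  ⊞-monoˡ : x ≼ y → x ⊞ z ≼ y ⊞ z
  ⊞-monoˡ p = ⇒-monoˡ (⇒-monoˡ p)

  ⊞-monoʳ : y ≼ z → x ⊞ y ≼ x ⊞ z
  ⊞-monoʳ = ⇒-monoʳ

  ⊞-mono : x ≼ y → z ≼ w → x ⊞ z ≼ y ⊞ w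
  ⊞-mono p q = ⊞-monoˡ p ⟫ ⊞-monoʳ q

  ⊞-comm : x ⊞ y ≼ y ⊞ x
  ⊞-comm = ax (ax-sfx _ _ _) ⟫ ⇒-monoʳ ~~-elim

  ⊞-𝟘ˡ : 𝟘 ⊞ x ≼ x
  ⊞-𝟘ˡ = mp ≼-refl (swap ≼-refl)

  ⊞-𝟘ˡ⁻ : x ≼ 𝟘 ⊞ x
  ⊞-𝟘ˡ⁻ = swap (~𝟘≼𝟙 ⟫ 𝟙≼ ≼-refl)

  ⊞-𝟘ʳ : x ⊞ 𝟘 ≼ x
  ⊞-𝟘ʳ = ~~-elim

  ⊞-𝟘ʳ⁻ : x ≼ x ⊞ 𝟘
  ⊞-𝟘ʳ⁻ = ~~-intro

  ~⊞-intro : ~ x · ~ y ≼ ~ (x ⊞ y)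
  ~⊞-intro = curry (·-assocʳ ⟫ ·-comm ⟫ ·-assocʳ ⟫ ·-monoʳ ⇒-eval ⟫ ⇒-eval)

  ~⊞-elim : ~ (x ⊞ y) ≼ ~ x · ~ y
  ~⊞-elim = ⇒-monoˡ (⇒-curry ⟫ ⇒-monoʳ ~~-elim) ⟫ ~~-elim

  ⊞-assocˡ : x ⊞ (y ⊞ z) ≼ (x ⊞ y) ⊞ z
  ⊞-assocˡ = ax (ax-res _ _ _) ⟫ ⇒-monoˡ ~⊞-elim

  ⊞-assocʳ : (x ⊞ y) ⊞ z ≼ x ⊞ (y ⊞ z)
  ⊞-assocʳ = ⇒-monoˡ ~⊞-intro ⟫ ⇒-curry

  ⊞-interchange : (x ⊞ y) ⊞ (z ⊞ w) ≼ (x ⊞ z) ⊞ (y ⊞ w)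
  ⊞-interchange = ⊞-assocʳ ⟫ ⊞-monoʳ (⊞-assocˡ ⟫ ⊞-monoˡ ⊞-comm ⟫ ⊞-assocʳ) ⟫ ⊞-assocˡ

  ⊞-·-distrib : (x ⊞ y) · z ≼ x ⊞ (y · z)
  ⊞-·-distrib = curry (·-assocʳ ⟫ ·-monoʳ ·-comm ⟫ ·-assocˡ ⟫ ·-monoˡ ⇒-eval)

  ⊞-·-interchange : (x ⊞ y) · (z · w) ≼ (x · z) ⊞ (y · w)
  ⊞-·-interchange = ·-assocˡ ⟫ ·-monoˡ (·-monoˡ ⊞-comm ⟫ ⊞-·-distrib ⟫ ⊞-comm) ⟫ ⊞-·-distrib

  -- `ax01` weakens `~ x · x ≼ 𝟘` to `~ x · x ≼ 𝟙`, so multiplying `x · y` by `~ x` gives something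
  -- below `y`.
  mix : x · y ≼ x ⊞ y
  mix = curry (·-comm ⟫ ·-assocˡ ⟫ ·-monoˡ (⇒-eval ⟫ ax01) ⟫ ·-𝟙ˡ)

  mul-mono : ∀ n → x ≼ y → mul n x ≼ mul n y
  mul-mono zero    p = ≼-refl
  mul-mono (suc n) p = ⊞-mono (mul-mono n p) p

  mul-+ : ∀ m n → mul m x ⊞ mul n x ≼ mul (m + n) x
  mul-+ zero    n = ⊞-𝟘ˡ
  mul-+ (suc m) n =
    ⊞-assocʳ ⟫ ⊞-monoʳ ⊞-comm ⟫ ⊞-assocˡ ⟫ ⊞-monoˡ (mul-+ m n)

  mul-* : ∀ m n → mul m (mul n x) ≼ mul (m * n) x
  mul-* zero    n = ≼-refl
  mul-* (suc m) n = ⊞-monoˡ (mul-* m n) ⟫ ⊞-comm ⟫ mul-+ n (m * n)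

  pow-mono : ∀ n → x ≼ y → pow x n ≼ pow y n
  pow-mono zero    p = ≼-refl
  pow-mono (suc n) p = ·-mono (pow-mono n p) p

  pow-+ : ∀ m n → pow x (m + n) ≼ pow x n · pow x m
  pow-+ zero    n = mp ⊢𝟙 (swap pair)
  pow-+ (suc m) n = ·-monoˡ (pow-+ m n) ⟫ ·-assocʳ

  pow-* : ∀ m n → pow x (m * n) ≼ pow (pow x n) m
  pow-* zero    n = ≼-refl
  pow-* (suc m) n = pow-+ n (m * n) ⟫ ·-monoˡ (pow-* m n)

  -- Iterates `mix`; at exponent 0 the claim would be `𝟙 ≼ 𝟘`.
  pow≼mul : ∀ n → pow x (suc n) ≼ mul (suc n) x
  pow≼mul zero    = ·-𝟙ˡ ⟫ ⊞-𝟘ˡ⁻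
  pow≼mul (suc n) = mix ⟫ ⊞-monoˡ (pow≼mul n)

  mul·pow : ∀ n → mul n x · pow y n ≼ mul n (x · y)
  mul·pow zero    = ·-comm ⟫ ·-𝟙ˡ
  mul·pow (suc n) = ⊞-·-interchange ⟫ ⊞-monoˡ (mul·pow n)

  pow-~≼~mul : ∀ n → pow (~ x) n ≼ ~ (mul n x)
  pow-~≼~mul zero    = 𝟙≼ ≼-refl
  pow-~≼~mul (suc n) = ·-monoˡ (pow-~≼~mul n) ⟫ ~⊞-intro

  ~mul≼pow-~ : ∀ n → ~ (mul n x) ≼ pow (~ x) n
  ~mul≼pow-~ zero    = ~𝟘≼𝟙
  ~mul≼pow-~ (suc n) = ~⊞-elim ⟫ ·-monoˡ (~mul≼pow-~ n)

  -- Passes through `(xᵏ)ʲ⁺¹ ≼ (j+1) xᵏ`, an instance of `pow≼mul`. It serves to bring two bounds to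
  -- a common exponent or multiple.
  pow-scale : ∀ k m j → pow x k ≼ mul m y → pow x (suc j * k) ≼ mul (suc j * m) y
  pow-scale k m j p = pow-* (suc j) k ⟫ pow-mono (suc j) p ⟫ pow≼mul j ⟫ mul-* (suc j) m

-- Substitution and weakening.

sub-mul : ∀ {b} (σ : ℕ → Fm b) n φ → sub σ (mul n φ) ≡ mul n (sub σ φ)
sub-mul σ zero    φ = refl
sub-mul σ (suc n) φ = cong (_⊞ sub σ φ) (sub-mul σ n φ)

sub-pow : ∀ {b} (σ : ℕ → Fm b) φ n → sub σ (pow φ n) ≡ pow (sub σ φ) n
sub-pow σ φ zero    = refl
sub-pow σ φ (suc n) = cong (_· sub σ φ) (sub-pow σ φ n)

sub-sub : (σ τ : ℕ → FmM) (φ : FmM) → sub σ (sub τ φ) ≡ sub (λ x → sub σ (τ x)) φ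
sub-sub σ τ (var x) = refl
sub-sub σ τ (φ ⇒ ψ) = cong₂ _⇒_ (sub-sub σ τ φ) (sub-sub σ τ ψ)
sub-sub σ τ (φ · ψ) = cong₂ _·_ (sub-sub σ τ φ) (sub-sub σ τ ψ)
sub-sub σ τ 𝟙 = refl
sub-sub σ τ 𝟘 = refl

sub-MLLAx : ∀ {b} {φ : Fm b} (σ : ℕ → Fm b) → MLLAx φ → MLLAx (sub σ φ)
sub-MLLAx σ (ax-sfx _ _ _)  = ax-sfx _ _ _
sub-MLLAx σ (ax-exch _ _ _) = ax-exch _ _ _
sub-MLLAx σ (ax-id _)       = ax-id _
sub-MLLAx σ (ax-dn _)       = ax-dn _
sub-MLLAx σ (ax-res _ _ _)  = ax-res _ _ _
sub-MLLAx σ (ax-fus _ _)    = ax-fus _ _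
sub-MLLAx σ (ax-1i _)       = ax-1i _
sub-MLLAx σ ax-1            = ax-1

module _ {A : FmM → Set} where

  MLL₀⇒MLL₀ᵘ-sub : ∀ {Γ φ} (σ : ℕ → FmM) → ∅ ⊢MLL₀[ A ] φ → Γ ⊢MLL₀ᵘ[ A ] sub σ φ
  MLL₀⇒MLL₀ᵘ-sub σ (ax a)    = ax (sub-MLLAx σ a)
  MLL₀⇒MLL₀ᵘ-sub σ ax01      = ax01
  MLL₀⇒MLL₀ᵘ-sub σ (axA {ψ} a τ) = subst (_ ⊢MLL₀ᵘ[ A ]_) (sym (sub-sub σ τ ψ)) (axA a _)
  MLL₀⇒MLL₀ᵘ-sub σ (mp d e)  = mp (MLL₀⇒MLL₀ᵘ-sub σ d) (MLL₀⇒MLL₀ᵘ-sub σ e)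

  weaken : ∀ {Γ Δ φ} → (∀ {ψ} → Γ ψ → Δ ψ) → Γ ⊢MLL₀ᵘ[ A ] φ → Δ ⊢MLL₀ᵘ[ A ] φ
  weaken f (hyp h)     = hyp (f h)
  weaken f (ax a)      = ax a
  weaken f ax01        = ax01
  weaken f (axA a σ)   = axA a σ
  weaken f (mp d e)    = mp (weaken f d) (weaken f e)
  weaken f (urule n d) = urule n (weaken f d)

-- Deduction and splitting in MLL₀ᵘ ⊕ A.

infixl 25 _∪_

_∪_ : (FmM → Set) → List FmM → FmM → Set
(Γ ∪ Δ) φ = Γ φ ⊎ φ ∈ Δ

module MLL₀ᵘOrder (A Γ : FmM → Set) = MLL₀Order (λ φ → Γ ⊢MLL₀ᵘ[ A ] φ) ax ax01 mp

-- Arbitrary bracketing and at least one summand: nontriviality needs no side condition on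
-- coefficients.
data Combination (P : FmM → Set) : FmM → Set where
  base : ∀ {φ} → P φ → Combination P φ
  _⊕_  : ∀ {φ ψ} → Combination P φ → Combination P ψ → Combination P (φ ⊞ ψ)

Alternatives : (A P Γ : FmM → Set) → Set
Alternatives A P Γ = ∃ λ χ → Combination P χ × Γ ⊢MLL₀ᵘ[ A ] χ

module Split (A : FmM → Set) (h : Hyp A) where

  n₀ : ℕ
  n₀ = proj₁ h

  mul^≼pow : ∀ Γ n φ → n₀ ≤ n →
    ∃ λ m → ∃ λ k → Γ ⊢MLL₀ᵘ[ A ] (pow (mul n φ) k ⇒ mul (suc m) (pow φ n))
  mul^≼pow Γ n φ n₀≤n with proj₂ h n n₀≤n
  ... | suc m , k , _ , d = m , k , subst (Γ ⊢MLL₀ᵘ[ A ]_) eq (MLL₀⇒MLL₀ᵘ-sub σ d)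
    where
    σ : ℕ → FmM
    σ _ = φ
    eq : sub σ (pow (mul n (var 0)) k ⇒ mul (suc m) (pow (var 0) n))
       ≡ (pow (mul n φ) k ⇒ mul (suc m) (pow φ n))
    eq = cong₂ _⇒_
      (trans (sub-pow σ (mul n (var 0)) k) (cong (λ x → pow x k) (sub-mul σ n (var 0))))
      (trans (sub-mul σ (suc m) (pow (var 0) n)) (cong (mul (suc m)) (sub-pow σ (var 0) n)))

  n₀≤*suc : ∀ c d → n₀ ≤ (suc c * suc n₀) * suc d
  n₀≤*suc c d = ≤-trans (n≤1+n n₀) (≤-trans (m≤n*m (suc n₀) (suc c)) (m≤m*n (suc c * suc n₀) (suc d)))

  *-rotate : ∀ p q r → (q * r) * p ≡ (p * r) * q
  *-rotate p q r = trans (*-comm (q * r) p) (trans (cong (p *_) (*-comm q r)) (sym (*-assoc p r q)))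

  -- Induction on the derivation. The multiple on the right absorbs `urule`, the power on the left
  -- repeated use of `ψ`.
  deduction : ∀ {Γ ψ Δ χ} → Γ ∪ (ψ ∷ Δ) ⊢MLL₀ᵘ[ A ] χ →
    ∃ λ k → ∃ λ m → Γ ∪ Δ ⊢MLL₀ᵘ[ A ] (pow ψ k ⇒ mul (suc m) χ)
  deduction {Γ} {ψ} {Δ} = go
    where
    open MLL₀ᵘOrder A (Γ ∪ Δ)
    theorem : ∀ {χ} → Γ ∪ Δ ⊢MLL₀ᵘ[ A ] χ → ∃ λ k → ∃ λ m → Γ ∪ Δ ⊢MLL₀ᵘ[ A ] (pow ψ k ⇒ mul (suc m) χ)
    theorem d = 0 , 0 , (𝟙≼ d ⟫ ⊞-𝟘ˡ⁻)
    go : ∀ {χ} → Γ ∪ (ψ ∷ Δ) ⊢MLL₀ᵘ[ A ] χ → ∃ λ k → ∃ λ m → Γ ∪ Δ ⊢MLL₀ᵘ[ A ] (pow ψ k ⇒ mul (suc m) χ)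
    go (hyp (inj₁ γ))            = theorem (hyp (inj₁ γ))
    go (hyp (inj₂ (here refl)))  = 1 , 0 , (·-𝟙ˡ ⟫ ⊞-𝟘ˡ⁻)
    go (hyp (inj₂ (there δ)))    = theorem (hyp (inj₂ δ))
    go (ax a)                    = theorem (ax a)
    go ax01                      = theorem ax01
    go (axA a σ)                 = theorem (axA a σ)
    go (urule n d) with go d
    ... | k , m , p = k , n + m * suc n , (p ⟫ mul-* (suc m) (suc n))
    -- With ψᵏ ≼ N φ and ψˡ ≼ N (φ ⇒ χ) for a common N ≥ n₀, the hypothesis turns N φ into
    -- M φᴺ, whose factors can be distributed over the summands of N (φ ⇒ χ).
    go (mp {φ} {χ} d e) with go d | go e
    ... | k , m , p | l , m′ , q with mul^≼pow (Γ ∪ Δ) ((suc m′ * suc n₀) * suc m) φ (n₀≤*suc m′ m)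
    -- `j * K` pays for the `j` factors `mul N φ` that `r` consumes, `suc M * L` for one copy of
    -- `mul N (φ ⇒ χ)` per resulting summand `pow φ N`.
    ... | M , j , r = j * K + suc M * L , _ , bound
      where
      -- Both `suc m` and `suc m′` divide `N`; the factor `suc n₀` lifts it above `n₀`.
      N K L : ℕ
      N = (suc m′ * suc n₀) * suc m
      K = (suc m′ * suc n₀) * k
      L = (suc m * suc n₀) * l
      pφ : pow ψ K ≼ mul N φ
      pφ = pow-scale k (suc m) (n₀ + m′ * suc n₀) p
      qφ : pow ψ L ≼ mul N (φ ⇒ χ)
      qφ = subst (λ n → pow ψ L ≼ mul n (φ ⇒ χ)) (sym (*-rotate (suc m) (suc m′) (suc n₀)))
             (pow-scale l (suc m′) (n₀ + m * suc n₀) q)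
      bound : pow ψ (j * K + suc M * L) ≼ mul (suc M * N) χ
      bound = pow-+ (j * K) (suc M * L)
            ⟫ ·-mono (pow-* (suc M) L ⟫ pow-mono (suc M) qφ) (pow-* j K ⟫ pow-mono j pφ ⟫ r)
            ⟫ ·-comm
            ⟫ mul·pow (suc M)
            ⟫ mul-mono (suc M) (·-comm ⟫ mul·pow N ⟫ mul-mono N ⇒-eval)
            ⟫ mul-* (suc M) N

  module _ {P : FmM → Set} where

    -- `mul k φ` contains a summand `𝟘` and is in general no combination. Its copies of `φ` are
    -- moved one by one onto `ψ`, which keeps the result nonempty even for `k = 0`.
    mul-⊞-combination : ∀ {φ ψ} k → Combination P φ → Combination P ψ →
      ∃ λ χ → Combination P χ × (∀ {Γ} → Γ ⊢MLL₀ᵘ[ A ] ((mul k φ ⊞ ψ) ⇒ χ))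
    mul-⊞-combination zero    c d = _ , d , λ {Γ} → let open MLL₀ᵘOrder A Γ in ⊞-𝟘ˡ
    mul-⊞-combination (suc k) c d with mul-⊞-combination k c (c ⊕ d)
    ... | χ , e , p = χ , e , λ {Γ} → let open MLL₀ᵘOrder A Γ in ⊞-assocʳ ⟫ p

    mul-alternatives : ∀ {Γ φ} m → Combination P φ → Γ ⊢MLL₀ᵘ[ A ] mul (suc m) φ → Alternatives A P Γ
    mul-alternatives m c d with mul-⊞-combination m c c
    ... | χ , e , p = χ , e , mp d p

    -- From ψᴺ ≼ c X and (~ ψ)ᴺ ≼ d Y one gets ~ (d Y) ≼ N ψ, so the hypothesis yields
    -- (~ (d Y))ʲ ≼ M ψᴺ ≼ M (c X), which says that j (d Y) ⊞ M (c X) is provable.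
    split : ∀ {Γ Δ} ψ → Alternatives A P (Γ ∪ (ψ ∷ Δ)) → Alternatives A P (Γ ∪ (~ ψ ∷ Δ)) →
      Alternatives A P (Γ ∪ Δ)
    split {Γ} {Δ} ψ (X , cX , d) (Y , cY , e) with deduction d | deduction e
    -- With exponent 0 the left side is `𝟙`, so the multiple of `X` holds without `ψ`. The last case
    -- can then take a common positive exponent `N`.
    ... | zero , m , p | _ = mul-alternatives m cX (mp (ax ax-1) p)
    ... | suc k , m , p | zero , m′ , q = mul-alternatives m′ cY (mp (ax ax-1) q)
    ... | suc k , m , p | suc l , m′ , q
        with mul^≼pow (Γ ∪ Δ) ((suc l * suc n₀) * suc k) ψ (n₀≤*suc l k)
    -- The count is the predecessor of `suc M * c`: one copy of `X` is the starting summand. As `j`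
    -- may be 0, copies of `Y` are added to `X′` and not the reverse.
    ... | M , j , r with mul-⊞-combination (m + (n₀ + l * suc n₀) * suc m + M * ((suc l * suc n₀) * suc m)) cX cX
    ... | X′ , cX′ , s with mul-⊞-combination (j * ((suc k * suc n₀) * suc m′)) cY cX′
    ... | Z , cZ , t = Z , cZ , mp (mp sum-provable (⊞-monoʳ s)) t
      where
      open MLL₀ᵘOrder A (Γ ∪ Δ)
      N c c′ : ℕ
      N  = (suc l * suc n₀) * suc k
      c  = (suc l * suc n₀) * suc m
      c′ = (suc k * suc n₀) * suc m′
      pX : pow ψ N ≼ mul c X
      pX = pow-scale (suc k) (suc m) (n₀ + l * suc n₀) p
      qY : pow (~ ψ) N ≼ mul c′ Y
      qY = subst (λ n → pow (~ ψ) n ≼ mul c′ Y) (*-rotate (suc l) (suc k) (suc n₀))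
             (pow-scale (suc l) (suc m′) (n₀ + k * suc n₀) q)
      ~Y≼ψ : ~ (mul c′ Y) ≼ mul N ψ
      ~Y≼ψ = ⇒-monoˡ (~mul≼pow-~ N ⟫ qY) ⟫ ~~-elim
      sum-provable : Γ ∪ Δ ⊢MLL₀ᵘ[ A ] (mul (j * c′) Y ⊞ mul (suc M * c) X)
      sum-provable = mp (~mul≼pow-~ j ⟫ pow-mono j ~Y≼ψ ⟫ r ⟫ mul-mono (suc M) pX ⟫ mul-* (suc M) c)
                        (⊞-monoˡ (mul-* j c′))

-- Embedding MLL₀ᵘ ⊕ A into IUL⋆ ⊕ A.

ι-mul : ∀ n φ → ι (mul n φ) ≡ mul n (ι φ)
ι-mul zero    φ = refl
ι-mul (suc n) φ = cong (_⊞ ι φ) (ι-mul n φ)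

ι-sub : ∀ σ φ → ι (sub σ φ) ≡ sub (λ x → ι (σ x)) (ι φ)
ι-sub σ (var x) = refl
ι-sub σ (φ ⇒ ψ) = cong₂ _⇒_ (ι-sub σ φ) (ι-sub σ ψ)
ι-sub σ (φ · ψ) = cong₂ _·_ (ι-sub σ φ) (ι-sub σ ψ)
ι-sub σ 𝟙 = refl
ι-sub σ 𝟘 = refl

ι-MLLAx : ∀ {φ} → MLLAx φ → MLLAx (ι φ)
ι-MLLAx (ax-sfx _ _ _)  = ax-sfx _ _ _
ι-MLLAx (ax-exch _ _ _) = ax-exch _ _ _
ι-MLLAx (ax-id _)       = ax-id _
ι-MLLAx (ax-dn _)       = ax-dn _
ι-MLLAx (ax-res _ _ _)  = ax-res _ _ _
ι-MLLAx (ax-fus _ _)    = ax-fus _ _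
ι-MLLAx (ax-1i _)       = ax-1i _
ι-MLLAx ax-1            = ax-1

module IUL⋆Order (A : FmM → Set) (Γ : FmL → Set) where

  open MLL₀Order (λ φ → Γ ⊢IUL⋆[ A ] φ) ax ax01 mp public

  private variable x y z : FmL

  ∧-lowerˡ : x ∧ y ≼ x
  ∧-lowerˡ = axL (ax-∧e₁ _ _)

  ∧-lowerʳ : x ∧ y ≼ y
  ∧-lowerʳ = axL (ax-∧e₂ _ _)

  ∧-glb : z ≼ x → z ≼ y → z ≼ x ∧ y
  ∧-glb p q = mp (adj p q) (axL (ax-∧i _ _ _))

  ∨-upperˡ : x ≼ x ∨ y
  ∨-upperˡ = axL (ax-∨i₁ _ _)

  ∨-upperʳ : y ≼ x ∨ y
  ∨-upperʳ = axL (ax-∨i₂ _ _)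

  ∨-lub : x ≼ z → y ≼ z → x ∨ y ≼ z
  ∨-lub p q = mp (adj p q) (axL (ax-∨e _ _ _))

  ≼𝟙⇒≼id : x ≼ 𝟙 → x ≼ y ⇒ y
  ≼𝟙⇒≼id p = p ⟫ 𝟙≼ ≼-refl

  -- By prelinearity: `(x ⇒ y) ∧ 𝟙` lies below `y` because `x ∨ y` is provable, and symmetrically
  -- for `x`.
  ∨-∧𝟙 : Γ ⊢IUL⋆[ A ] (x ∨ y) → Γ ⊢IUL⋆[ A ] ((x ∧ 𝟙) ∨ (y ∧ 𝟙))
  ∨-∧𝟙 {x} {y} d = mp (prelin x y)
    (∨-lub (∧-glb (mp d (∨-lub (swap ∧-lowerˡ) (swap (≼𝟙⇒≼id ∧-lowerʳ)))) ∧-lowerʳ ⟫ ∨-upperʳ)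
           (∧-glb (mp d (∨-lub (swap (≼𝟙⇒≼id ∧-lowerʳ)) (swap ∧-lowerˡ))) ∧-lowerʳ ⟫ ∨-upperˡ))

  pow≼𝟙 : ∀ n → x ≼ 𝟙 → pow x n ≼ 𝟙
  pow≼𝟙 zero    p = ≼-refl
  pow≼𝟙 (suc n) p = ·-mono (pow≼𝟙 n p) p ⟫ ·-𝟙ˡ

  -- On multiplying `pow x n ∨ y` by `x ∨ y`, the mixed product `pow x n · y` falls below `y`, since
  -- `pow x n ≼ 𝟙`.
  pow-∨ : ∀ n → x ≼ 𝟙 → y ≼ 𝟙 → Γ ⊢IUL⋆[ A ] (x ∨ y) → Γ ⊢IUL⋆[ A ] (pow x n ∨ y)
  pow-∨ zero    p q d = mp ⊢𝟙 ∨-upperˡ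
  pow-∨ (suc n) p q d = mp (pow-∨ n p q d) (∨-lub
    (mp d (∨-lub (swap (pair ⟫ ⇒-monoʳ ∨-upperˡ)) (swap (≼𝟙⇒≼id (pow≼𝟙 n p)) ⟫ ⇒-monoʳ ∨-upperʳ)))
    ∨-upperʳ)

  -- Both disjuncts of (~ x ∧ 𝟙)ⁿ ∨ (~ ~ x ∧ 𝟙) lie below ~ ~ x, the first since (~ x)ⁿ⁺¹ ≼ 𝟘.
  mul-cancel : ∀ n → Γ ⊢IUL⋆[ A ] mul (suc n) x → Γ ⊢IUL⋆[ A ] x
  mul-cancel {x} n d = mp (mp (pow-∨ n ∧-lowerʳ ∧-lowerʳ (∨-∧𝟙 (exmid (~ x))))
    (∨-lub (curry (·-monoˡ (pow-mono n ∧-lowerˡ) ⟫ pow-~≼~mul (suc n) ⟫ mp d ~~-intro)) ∧-lowerˡ)) ~~-elim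

MLL₀ᵘ⇒IUL⋆ : ∀ {A Γ φ} → Γ ⊢MLL₀ᵘ[ A ] φ → ιSet Γ ⊢IUL⋆[ A ] ι φ
MLL₀ᵘ⇒IUL⋆ (hyp h)     = hyp (_ , h , refl)
MLL₀ᵘ⇒IUL⋆ (ax a)      = ax (ι-MLLAx a)
MLL₀ᵘ⇒IUL⋆ ax01        = ax01
MLL₀ᵘ⇒IUL⋆ {A} (axA {ψ} a σ) = subst (_ ⊢IUL⋆[ A ]_) (sym (ι-sub σ ψ)) (axA a _)
MLL₀ᵘ⇒IUL⋆ (mp d e)    = mp (MLL₀ᵘ⇒IUL⋆ d) (MLL₀ᵘ⇒IUL⋆ e)
MLL₀ᵘ⇒IUL⋆ {A} {Γ} (urule n {φ} d) =
  IUL⋆Order.mul-cancel A (ιSet Γ) n (subst (ιSet Γ ⊢IUL⋆[ A ]_) (ι-mul (suc n) φ) (MLL₀ᵘ⇒IUL⋆ d))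

-- From linear combinations to disjunctions in IUL⋆.

module _ (A Γ : FmM → Set) where

  open IUL⋆Order A (ιSet Γ)

  foldl-∨-upper : ∀ {n} (φ : FmL) (φs : Vec FmL n) → φ ≼ foldl (λ _ → FmL) _∨_ φ φs
  foldl-∨-upper φ []       = ≼-refl
  foldl-∨-upper φ (ψ ∷ φs) = ∨-upperˡ ⟫ foldl-∨-upper (φ ∨ ψ) φs

  lookup≼foldl-∨ : ∀ {n} (φ : FmL) (φs : Vec FmM n) i →
    ι (lookup φs i) ≼ foldl (λ _ → FmL) _∨_ φ (map ι φs)
  lookup≼foldl-∨ φ (ψ ∷ φs) zero    = ∨-upperʳ ⟫ foldl-∨-upper (φ ∨ ι ψ) (map ι φs)
  lookup≼foldl-∨ φ (ψ ∷ φs) (suc i) = lookup≼foldl-∨ (φ ∨ ι ψ) φs i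

  lookup≼bigOr : ∀ {n} (φs : Vec FmM (suc n)) i → ι (lookup φs i) ≼ bigOr (map ι φs)
  lookup≼bigOr (φ ∷ φs) zero    = foldl-∨-upper (ι φ) (map ι φs)
  lookup≼bigOr (φ ∷ φs) (suc i) = lookup≼foldl-∨ (ι φ) φs i

  ι-mul≼ : ∀ {φ χ} n → ι φ ≼ χ → ι (mul n φ) ≼ mul n χ
  ι-mul≼ {φ} {χ} n p = subst (_≼ mul n χ) (sym (ι-mul n φ)) (mul-mono n p)

  foldl-⊞≼mul : ∀ {n φ χ} c (λs : Vec ℕ n) (φs : Vec FmM n) → ι φ ≼ mul c χ → (∀ i → ι (lookup φs i) ≼ χ) →
    ι (foldl (λ _ → FmM) _⊞_ φ (zipWith mul λs φs)) ≼ mul (c + sum λs) χ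
  foldl-⊞≼mul {φ = φ} {χ} c [] [] p q = subst (λ n → ι φ ≼ mul n χ) (sym (+-identityʳ c)) p
  foldl-⊞≼mul {φ = φ} {χ} c (l ∷ λs) (ψ ∷ φs) p q =
    subst (λ n → ι (foldl (λ _ → FmM) _⊞_ φ (zipWith mul (l ∷ λs) (ψ ∷ φs))) ≼ mul n χ)
          (+-assoc c l (sum λs))
          (foldl-⊞≼mul (c + l) λs φs (⊞-mono p (ι-mul≼ l (q zero)) ⟫ mul-+ c l) (λ i → q (suc i)))

  linComb≼mul : ∀ {n χ} (λs : Vec ℕ (suc n)) (φs : Vec FmM (suc n)) → (∀ i → ι (lookup φs i) ≼ χ) →
    ι (linComb λs φs) ≼ mul (sum λs) χ
  linComb≼mul (l ∷ λs) (φ ∷ φs) q = foldl-⊞≼mul l λs φs (ι-mul≼ l (q zero)) (λ i → q (suc i))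

lookup≤sum : ∀ {n} (λs : Vec ℕ n) i → lookup λs i ≤ sum λs
lookup≤sum (l ∷ λs) zero    = m≤m+n l (sum λs)
lookup≤sum (l ∷ λs) (suc i) = ≤-trans (lookup≤sum λs i) (m≤n+m (sum λs) l)

-- Each formula lies below the disjunction, so the combination lies below `sum λs` copies of it.
-- This number is positive, and `mul-cancel` applies.
linComb⇒bigOr : ∀ {A Γ n} (λs : Vec ℕ (suc n)) (φs : Vec FmM (suc n)) i → lookup λs i ≢ 0 →
  ιSet Γ ⊢IUL⋆[ A ] ι (linComb λs φs) → ιSet Γ ⊢IUL⋆[ A ] bigOr (map ι φs)
linComb⇒bigOr {A} {Γ} λs φs i λᵢ≢0 d = cancel (sum λs) (≤-trans (n≢0⇒n>0 λᵢ≢0) (lookup≤sum λs i))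
    (mp d (linComb≼mul A Γ λs φs (lookup≼bigOr A Γ φs)))
  where
  cancel : ∀ {χ} n → 1 ≤ n → ιSet Γ ⊢IUL⋆[ A ] mul n χ → ιSet Γ ⊢IUL⋆[ A ] χ
  cancel (suc n) _ = IUL⋆Order.mul-cancel A (ιSet Γ) n

-- Finite case distinctions as binary trees.

data Cover (P : List FmM → Set) (Δ : List FmM) : Set where
  leaf   : P Δ → Cover P Δ
  branch : ∀ ψ → Cover P (ψ ∷ Δ) → Cover P (~ ψ ∷ Δ) → Cover P Δ

infixl 1 _>>=_

_>>=_ : ∀ {P Q Δ} → Cover P Δ → (∀ {Δ′} → Δ ⊆ Δ′ → P Δ′ → Cover Q Δ′) → Cover Q Δ
leaf p       >>= f = f ⊆-refl p
branch ψ c d >>= f = branch ψ (c >>= λ s → f (⊆-trans (xs⊆x∷xs _ ψ) s))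
                              (d >>= λ s → f (⊆-trans (xs⊆x∷xs _ (~ ψ)) s))

-- The second tree is grafted at the leaves of the first, hence must exist over every `Δ`; `mono`
-- carries the first result to the deeper leaves.
zipCover : ∀ {P Q Δ} → (∀ {Δ Δ′} → Δ ⊆ Δ′ → P Δ → P Δ′) →
  Cover P Δ → (∀ {Δ} → Cover Q Δ) → Cover (λ Δ → P Δ × Q Δ) Δ
zipCover mono c d = c >>= λ _ p → d >>= λ s q → leaf (mono s p , q)

varBound : FmM → ℕ
varBound (var x) = suc x
varBound (φ ⇒ ψ) = varBound φ ⊔ varBound ψ
varBound (φ · ψ) = varBound φ ⊔ varBound ψ
varBound 𝟙 = 0
varBound 𝟘 = 0

-- Interpreting IUL⋆ derivations over the trees.

module Evaluation (A Γ : FmM → Set) where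

  infix 4 _⊢_ _⊩_⇓_

  _⊢_ : List FmM → FmM → Set
  Δ ⊢ φ = Γ ∪ Δ ⊢MLL₀ᵘ[ A ] φ

  ⊢-mono : ∀ {Δ Δ′ φ} → Δ ⊆ Δ′ → Δ ⊢ φ → Δ′ ⊢ φ
  ⊢-mono s = weaken λ { (inj₁ γ) → inj₁ γ ; (inj₂ δ) → inj₂ (s δ) }

  -- In a linearly ordered model a meet or join is one of its arguments, so a lattice
  -- formula takes the value of a multiplicative one once enough comparisons are decided.
  data _⊩_⇓_ (Δ : List FmM) : FmL → FmM → Set where
    var : ∀ x → Δ ⊩ var x ⇓ var x
    _⇒_ : ∀ {φ ψ a b} → Δ ⊩ φ ⇓ a → Δ ⊩ ψ ⇓ b → Δ ⊩ (φ ⇒ ψ) ⇓ (a ⇒ b)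
    _·_ : ∀ {φ ψ a b} → Δ ⊩ φ ⇓ a → Δ ⊩ ψ ⇓ b → Δ ⊩ (φ · ψ) ⇓ (a · b)
    𝟙   : Δ ⊩ 𝟙 ⇓ 𝟙
    𝟘   : Δ ⊩ 𝟘 ⇓ 𝟘
    ∧ˡ  : ∀ {φ ψ a b} → Δ ⊩ φ ⇓ a → Δ ⊩ ψ ⇓ b → Δ ⊢ (a ⇒ b) → Δ ⊩ (φ ∧ ψ) ⇓ a
    ∧ʳ  : ∀ {φ ψ a b} → Δ ⊩ φ ⇓ a → Δ ⊩ ψ ⇓ b → Δ ⊢ (b ⇒ a) → Δ ⊩ (φ ∧ ψ) ⇓ b
    ∨ˡ  : ∀ {φ ψ a b} → Δ ⊩ φ ⇓ a → Δ ⊩ ψ ⇓ b → Δ ⊢ (b ⇒ a) → Δ ⊩ (φ ∨ ψ) ⇓ a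
    ∨ʳ  : ∀ {φ ψ a b} → Δ ⊩ φ ⇓ a → Δ ⊩ ψ ⇓ b → Δ ⊢ (a ⇒ b) → Δ ⊩ (φ ∨ ψ) ⇓ b

  ⇓-mono : ∀ {Δ Δ′ φ a} → Δ ⊆ Δ′ → Δ ⊩ φ ⇓ a → Δ′ ⊩ φ ⇓ a
  ⇓-mono s (var x)    = var x
  ⇓-mono s (d ⇒ e)    = ⇓-mono s d ⇒ ⇓-mono s e
  ⇓-mono s (d · e)    = ⇓-mono s d · ⇓-mono s e
  ⇓-mono s 𝟙          = 𝟙
  ⇓-mono s 𝟘          = 𝟘
  ⇓-mono s (∧ˡ d e p) = ∧ˡ (⇓-mono s d) (⇓-mono s e) (⊢-mono s p)
  ⇓-mono s (∧ʳ d e p) = ∧ʳ (⇓-mono s d) (⇓-mono s e) (⊢-mono s p)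
  ⇓-mono s (∨ˡ d e p) = ∨ˡ (⇓-mono s d) (⇓-mono s e) (⊢-mono s p)
  ⇓-mono s (∨ʳ d e p) = ∨ʳ (⇓-mono s d) (⇓-mono s e) (⊢-mono s p)

  -- When both comparisons of `a` and `b` are provable, a meet or join may take either value. By
  -- symmetry in the two evaluations, the values are provably equivalent.
  ⇓-unique : ∀ {Δ} φ {a a′} → Δ ⊩ φ ⇓ a → Δ ⊩ φ ⇓ a′ → Δ ⊢ (a ⇒ a′)
  ⇓-unique {Δ} = go
    where
    open MLL₀ᵘOrder A (Γ ∪ Δ)
    go : ∀ φ {a a′} → Δ ⊩ φ ⇓ a → Δ ⊩ φ ⇓ a′ → a ≼ a′
    go (var x) (var .x) (var .x) = ≼-refl
    go (φ ⇒ ψ) (d ⇒ e) (d′ ⇒ e′) = ⇒-monoˡ (go φ d′ d) ⟫ ⇒-monoʳ (go ψ e e′)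
    go (φ · ψ) (d · e) (d′ · e′) = ·-mono (go φ d d′) (go ψ e e′)
    go 𝟙 𝟙 𝟙 = ≼-refl
    go 𝟘 𝟘 𝟘 = ≼-refl
    go (φ ∧ ψ) (∧ˡ d e p) (∧ˡ d′ e′ p′) = go φ d d′
    go (φ ∧ ψ) (∧ˡ d e p) (∧ʳ d′ e′ p′) = p ⟫ go ψ e e′
    go (φ ∧ ψ) (∧ʳ d e p) (∧ˡ d′ e′ p′) = p ⟫ go φ d d′
    go (φ ∧ ψ) (∧ʳ d e p) (∧ʳ d′ e′ p′) = go ψ e e′
    go (φ ∨ ψ) (∨ˡ d e p) (∨ˡ d′ e′ p′) = go φ d d′
    go (φ ∨ ψ) (∨ˡ d e p) (∨ʳ d′ e′ p′) = go φ d d′ ⟫ p′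
    go (φ ∨ ψ) (∨ʳ d e p) (∨ˡ d′ e′ p′) = go ψ e e′ ⟫ p′
    go (φ ∨ ψ) (∨ʳ d e p) (∨ʳ d′ e′ p′) = go ψ e e′

  ι⇓ : ∀ {Δ} φ → Δ ⊩ ι φ ⇓ φ
  ι⇓ (var x) = var x
  ι⇓ (φ ⇒ ψ) = ι⇓ φ ⇒ ι⇓ ψ
  ι⇓ (φ · ψ) = ι⇓ φ · ι⇓ ψ
  ι⇓ 𝟙 = 𝟙
  ι⇓ 𝟘 = 𝟘

  ι⇓⁻¹ : ∀ {Δ} φ {a} → Δ ⊩ ι φ ⇓ a → a ≡ φ
  ι⇓⁻¹ (var x) (var .x) = refl
  ι⇓⁻¹ (φ ⇒ ψ) (d ⇒ e)  = cong₂ _⇒_ (ι⇓⁻¹ φ d) (ι⇓⁻¹ ψ e)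
  ι⇓⁻¹ (φ · ψ) (d · e)  = cong₂ _·_ (ι⇓⁻¹ φ d) (ι⇓⁻¹ ψ e)
  ι⇓⁻¹ 𝟙 𝟙 = refl
  ι⇓⁻¹ 𝟘 𝟘 = refl

  Evaluates Forces : FmL → List FmM → Set
  Evaluates φ Δ = ∃ λ a → Δ ⊩ φ ⇓ a
  Forces    φ Δ = ∃ λ a → Δ ⊩ φ ⇓ a × Δ ⊢ a

  -- By `mix`, `b · ~ a ≼ ~ a ⊞ b ≼ a ⇒ b ≼ 𝟘`, hence `b ≼ ~ (~ a) ≼ a`. So a single branching
  -- compares any two formulas.
  ¬⇒-flip : ∀ {Δ} a b → Δ ⊢ (~ (a ⇒ b)) → Δ ⊢ (b ⇒ a)
  ¬⇒-flip {Δ} a b d = curry (·-comm ⟫ mix ⟫ ⇒-monoˡ ~~-intro ⟫ d) ⟫ ~~-elim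
    where open MLL₀ᵘOrder A (Γ ∪ Δ)

  compare : ∀ {Δ} a b → Cover (λ Δ → Δ ⊢ (a ⇒ b) ⊎ Δ ⊢ (b ⇒ a)) Δ
  compare a b = branch (a ⇒ b) (leaf (inj₁ (hyp (inj₂ (here refl)))))
                               (leaf (inj₂ (¬⇒-flip a b (hyp (inj₂ (here refl))))))

  Evaluates-mono : ∀ {φ Δ Δ′} → Δ ⊆ Δ′ → Evaluates φ Δ → Evaluates φ Δ′
  Evaluates-mono s (a , d) = a , ⇓-mono s d

  Forces-mono : ∀ {φ Δ Δ′} → Δ ⊆ Δ′ → Forces φ Δ → Forces φ Δ′
  Forces-mono s (a , d , p) = a , ⇓-mono s d , ⊢-mono s p

  evaluate : ∀ {Δ} φ → Cover (Evaluates φ) Δ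
  evaluate (var x) = leaf (_ , var x)
  evaluate (φ ⇒ ψ) = zipCover Evaluates-mono (evaluate φ) (evaluate ψ) >>= λ
    { _ ((_ , d) , (_ , e)) → leaf (_ , d ⇒ e) }
  evaluate (φ · ψ) = zipCover Evaluates-mono (evaluate φ) (evaluate ψ) >>= λ
    { _ ((_ , d) , (_ , e)) → leaf (_ , d · e) }
  evaluate 𝟙 = leaf (_ , 𝟙)
  evaluate 𝟘 = leaf (_ , 𝟘)
  evaluate (φ ∧ ψ) = zipCover Evaluates-mono (evaluate φ) (evaluate ψ) >>= λ
    { _ ((a , d) , (b , e)) → compare a b >>= λ
      { s (inj₁ p) → leaf (_ , ∧ˡ (⇓-mono s d) (⇓-mono s e) p)
      ; s (inj₂ p) → leaf (_ , ∧ʳ (⇓-mono s d) (⇓-mono s e) p) } }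
  evaluate (φ ∨ ψ) = zipCover Evaluates-mono (evaluate φ) (evaluate ψ) >>= λ
    { _ ((a , d) , (b , e)) → compare a b >>= λ
      { s (inj₁ p) → leaf (_ , ∨ʳ (⇓-mono s d) (⇓-mono s e) p)
      ; s (inj₂ p) → leaf (_ , ∨ˡ (⇓-mono s d) (⇓-mono s e) p) } }

  evaluating₁ : ∀ {Q Δ} φ → (∀ {Δ a} → Δ ⊩ φ ⇓ a → Cover Q Δ) → Cover Q Δ
  evaluating₁ φ f = evaluate φ >>= λ { _ (_ , d) → f d }

  evaluating₂ : ∀ {Q Δ} φ ψ → (∀ {Δ a b} → Δ ⊩ φ ⇓ a → Δ ⊩ ψ ⇓ b → Cover Q Δ) → Cover Q Δ
  evaluating₂ φ ψ f = evaluating₁ φ λ d → evaluate ψ >>= λ { s (_ , e) → f (⇓-mono s d) e }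

  evaluating₃ : ∀ {Q Δ} φ ψ χ →
    (∀ {Δ a b c} → Δ ⊩ φ ⇓ a → Δ ⊩ ψ ⇓ b → Δ ⊩ χ ⇓ c → Cover Q Δ) → Cover Q Δ
  evaluating₃ φ ψ χ f = evaluating₂ φ ψ λ d e → evaluate χ >>= λ { s (_ , g) → f (⇓-mono s d) (⇓-mono s e) g }

  comparing : ∀ {Q Δ φ ψ a b} → Δ ⊩ φ ⇓ a → Δ ⊩ ψ ⇓ b →
    (∀ {Δ′} → Δ ⊆ Δ′ → Δ′ ⊩ φ ⇓ a → Δ′ ⊩ ψ ⇓ b → Δ′ ⊢ (a ⇒ b) → Cover Q Δ′) →
    (∀ {Δ′} → Δ ⊆ Δ′ → Δ′ ⊩ φ ⇓ a → Δ′ ⊩ ψ ⇓ b → Δ′ ⊢ (b ⇒ a) → Cover Q Δ′) → Cover Q Δ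
  comparing d e f g = compare _ _ >>= λ
    { s (inj₁ p) → f s (⇓-mono s d) (⇓-mono s e) p
    ; s (inj₂ p) → g s (⇓-mono s d) (⇓-mono s e) p }

  force-MLLAx : ∀ {Δ φ} → MLLAx φ → Cover (Forces φ) Δ
  force-MLLAx (ax-sfx φ ψ χ)  = evaluating₃ φ ψ χ λ d e f →
    leaf (_ , (d ⇒ e) ⇒ ((e ⇒ f) ⇒ (d ⇒ f)) , ax (ax-sfx _ _ _))
  force-MLLAx (ax-exch φ ψ χ) = evaluating₃ φ ψ χ λ d e f →
    leaf (_ , (d ⇒ (e ⇒ f)) ⇒ (e ⇒ (d ⇒ f)) , ax (ax-exch _ _ _))
  force-MLLAx (ax-id φ)       = evaluating₁ φ λ d → leaf (_ , d ⇒ d , ax (ax-id _))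
  force-MLLAx (ax-dn φ)       = evaluating₁ φ λ d → leaf (_ , ((d ⇒ 𝟘) ⇒ 𝟘) ⇒ d , ax (ax-dn _))
  force-MLLAx (ax-res φ ψ χ)  = evaluating₃ φ ψ χ λ d e f →
    leaf (_ , (d ⇒ (e ⇒ f)) ⇒ ((d · e) ⇒ f) , ax (ax-res _ _ _))
  force-MLLAx (ax-fus φ ψ)    = evaluating₂ φ ψ λ d e → leaf (_ , d ⇒ (e ⇒ (d · e)) , ax (ax-fus _ _))
  force-MLLAx (ax-1i φ)       = evaluating₁ φ λ d → leaf (_ , d ⇒ (𝟙 ⇒ d) , ax (ax-1i _))
  force-MLLAx ax-1            = leaf (_ , 𝟙 , ax ax-1)

  force-LatAx : ∀ {Δ φ} → LatAx φ → Cover (Forces φ) Δ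
  force-LatAx (ax-∧e₁ φ ψ) = evaluating₂ φ ψ λ d e → comparing d e
    (λ _ d e p → leaf (_ , ∧ˡ d e p ⇒ d , ax (ax-id _)))
    (λ _ d e p → leaf (_ , ∧ʳ d e p ⇒ d , p))
  force-LatAx (ax-∧e₂ φ ψ) = evaluating₂ φ ψ λ d e → comparing d e
    (λ _ d e p → leaf (_ , ∧ˡ d e p ⇒ e , p))
    (λ _ d e p → leaf (_ , ∧ʳ d e p ⇒ e , ax (ax-id _)))
  force-LatAx (ax-∨i₁ φ ψ) = evaluating₂ φ ψ λ d e → comparing d e
    (λ _ d e p → leaf (_ , d ⇒ ∨ʳ d e p , p))
    (λ _ d e p → leaf (_ , d ⇒ ∨ˡ d e p , ax (ax-id _)))
  force-LatAx (ax-∨i₂ φ ψ) = evaluating₂ φ ψ λ d e → comparing d e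
    (λ _ d e p → leaf (_ , e ⇒ ∨ʳ d e p , ax (ax-id _)))
    (λ _ d e p → leaf (_ , e ⇒ ∨ˡ d e p , p))
  -- Comparing the values of `ψ` and `χ` decides both meets alike, so the two sides get the same
  -- value.
  force-LatAx (ax-∧i φ ψ χ) = evaluating₃ φ ψ χ λ d e f → comparing e f
    (λ {Δ} s e f p → let open MLL₀ᵘOrder A (Γ ∪ Δ); d = ⇓-mono s d in
      leaf (_ , ∧ˡ (d ⇒ e) (d ⇒ f) (⇒-monoʳ p) ⇒ (d ⇒ ∧ˡ e f p) , ≼-refl))
    (λ {Δ} s e f p → let open MLL₀ᵘOrder A (Γ ∪ Δ); d = ⇓-mono s d in
      leaf (_ , ∧ʳ (d ⇒ e) (d ⇒ f) (⇒-monoʳ p) ⇒ (d ⇒ ∧ʳ e f p) , ≼-refl))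
  force-LatAx (ax-∨e φ ψ χ) = evaluating₃ φ ψ χ λ d e f → comparing d e
    (λ {Δ} s d e p → let open MLL₀ᵘOrder A (Γ ∪ Δ); f = ⇓-mono s f in
      leaf (_ , ∧ʳ (d ⇒ f) (e ⇒ f) (⇒-monoˡ p) ⇒ (∨ʳ d e p ⇒ f) , ≼-refl))
    (λ {Δ} s d e p → let open MLL₀ᵘOrder A (Γ ∪ Δ); f = ⇓-mono s f in
      leaf (_ , ∧ˡ (d ⇒ f) (e ⇒ f) (⇒-monoˡ p) ⇒ (∨ˡ d e p ⇒ f) , ≼-refl))

  force-∧ : ∀ {Δ φ ψ} → Forces φ Δ → Forces ψ Δ → Cover (Forces (φ ∧ ψ)) Δ
  force-∧ (_ , d , x) (_ , e , y) = comparing d e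
    (λ s d e p → leaf (_ , ∧ˡ d e p , ⊢-mono s x))
    (λ s d e p → leaf (_ , ∧ʳ d e p , ⊢-mono s y))

  force-∨ˡ : ∀ {Δ φ} ψ → Forces φ Δ → Cover (Forces (φ ∨ ψ)) Δ
  force-∨ˡ ψ (_ , d , x) = evaluate ψ >>= λ { s (_ , e) → comparing (⇓-mono s d) e
    (λ t d e p → leaf (_ , ∨ʳ d e p , mp (⊢-mono (⊆-trans s t) x) p))
    (λ t d e p → leaf (_ , ∨ˡ d e p , ⊢-mono (⊆-trans s t) x)) }

  force-∨ʳ : ∀ {Δ ψ} φ → Forces ψ Δ → Cover (Forces (φ ∨ ψ)) Δ
  force-∨ʳ φ (_ , e , y) = evaluate φ >>= λ { s (_ , d) → comparing d (⇓-mono s e)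
    (λ t d e p → leaf (_ , ∨ʳ d e p , ⊢-mono (⊆-trans s t) y))
    (λ t d e p → leaf (_ , ∨ˡ d e p , mp (⊢-mono (⊆-trans s t) y) p)) }

  force-𝟙 : ∀ {Δ} → Forces 𝟙 Δ
  force-𝟙 = 𝟙 , 𝟙 , ax ax-1

  -- A finite tree evaluates only finitely many `σ x`, but an axiom of `A` has no variables beyond
  -- its `varBound`. Its instance under `σ` thus evaluates to its instance under `τ`.
  evaluate-below : ∀ {Δ} (σ : ℕ → FmL) n → Cover (λ Δ → ∃ λ τ → ∀ x → x < n → Δ ⊩ σ x ⇓ τ x) Δ
  evaluate-below σ zero    = leaf (var , λ _ ())
  evaluate-below σ (suc n) = evaluate-below σ n >>= λ { _ (τ , f) → evaluate (σ n) >>= λ { s (a , d) →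
    leaf (update τ a , λ x x<1+n → lemma τ a (λ y y<n → ⇓-mono s (f y y<n)) d x x<1+n) } }
    where
    update : (ℕ → FmM) → FmM → ℕ → FmM
    update τ a x with x ≟ n
    ... | yes _ = a
    ... | no  _ = τ x
    lemma : ∀ {Δ} τ a → (∀ x → x < n → Δ ⊩ σ x ⇓ τ x) → Δ ⊩ σ n ⇓ a →
      ∀ x → x < suc n → Δ ⊩ σ x ⇓ update τ a x
    lemma τ a f d x x<1+n with x ≟ n
    ... | yes refl = d
    ... | no  x≢n  = f x (≤∧≢⇒< (≤-pred x<1+n) x≢n)

  sub⇓ : ∀ {Δ} σ τ φ n → varBound φ ≤ n → (∀ x → x < n → Δ ⊩ σ x ⇓ τ x) → Δ ⊩ sub σ (ι φ) ⇓ sub τ φ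
  sub⇓ σ τ (var x) n p f = f x p
  sub⇓ σ τ (φ ⇒ ψ) n p f = sub⇓ σ τ φ n (m⊔n≤o⇒m≤o _ _ p) f ⇒ sub⇓ σ τ ψ n (m⊔n≤o⇒n≤o (varBound φ) _ p) f
  sub⇓ σ τ (φ · ψ) n p f = sub⇓ σ τ φ n (m⊔n≤o⇒m≤o _ _ p) f · sub⇓ σ τ ψ n (m⊔n≤o⇒n≤o (varBound φ) _ p) f
  sub⇓ σ τ 𝟙 n p f = 𝟙
  sub⇓ σ τ 𝟘 n p f = 𝟘

  soundness : ∀ {Δ φ} → ιSet Γ ⊢IUL⋆[ A ] φ → Cover (Forces φ) Δ
  soundness (hyp (ψ , γ , refl)) = leaf (ψ , ι⇓ ψ , hyp (inj₁ γ))
  soundness (ax a)       = force-MLLAx a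
  soundness (axL a)      = force-LatAx a
  soundness (prelin φ ψ) = evaluating₂ φ ψ λ d e → comparing d e
    (λ _ d e p → force-∧ (_ , d ⇒ e , p) force-𝟙 >>= λ _ x → force-∨ˡ ((ψ ⇒ φ) ∧ 𝟙) x)
    (λ _ d e p → force-∧ (_ , e ⇒ d , p) force-𝟙 >>= λ _ x → force-∨ʳ ((φ ⇒ ψ) ∧ 𝟙) x)
  -- The branching is on the value `a`, as only multiplicative formulas can be assumed.
  soundness (exmid φ)    = evaluating₁ φ λ {_} {a} d → branch a
    (force-∨ˡ (~ φ) (a , ⇓-mono (xs⊆x∷xs _ a) d , hyp (inj₂ (here refl))))
    (force-∨ʳ φ (~ a , ⇓-mono (xs⊆x∷xs _ (~ a)) d ⇒ 𝟘 , hyp (inj₂ (here refl))))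
  soundness ax01         = leaf (_ , 𝟘 ⇒ 𝟙 , ax01)
  soundness (axA {ψ} a σ) = evaluate-below σ (varBound ψ) >>= λ { _ (τ , f) →
    leaf (_ , sub⇓ σ τ ψ (varBound ψ) ≤-refl f , axA a τ) }
  -- The two premises may give `φ` different values, which `⇓-unique` reconciles.
  soundness (mp {φ} d e) = zipCover Forces-mono (soundness d) (soundness e) >>= λ
    { _ ((a , u , x) , (_ , v ⇒ w , y)) → leaf (_ , w , mp (mp x (⇓-unique φ u v)) y) }
  soundness (adj d e)    = zipCover Forces-mono (soundness d) (soundness e) >>= λ
    { _ (x , y) → force-∧ x y }

  foldl-∨⇓ : ∀ {Δ n a} φ (φs : Vec FmM n) → Δ ⊩ foldl (λ _ → FmL) _∨_ φ (map ι φs) ⇓ a →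
    Δ ⊩ φ ⇓ a ⊎ ∃ λ i → a ≡ lookup φs i
  foldl-∨⇓ φ []       d = inj₁ d
  foldl-∨⇓ φ (ψ ∷ φs) d with foldl-∨⇓ (φ ∨ ι ψ) φs d
  ... | inj₁ (∨ˡ d _ _) = inj₁ d
  ... | inj₁ (∨ʳ _ e _) = inj₂ (zero , ι⇓⁻¹ ψ e)
  ... | inj₂ (i , eq)   = inj₂ (suc i , eq)

  -- A join takes the value of one of its disjuncts, and a multiplicative disjunct has no value but
  -- itself.
  bigOr⇓ : ∀ {Δ n a} (φs : Vec FmM (suc n)) → Δ ⊩ bigOr (map ι φs) ⇓ a → ∃ λ i → a ≡ lookup φs i
  bigOr⇓ (φ ∷ φs) d with foldl-∨⇓ (ι φ) φs d
  ... | inj₁ e        = zero , ι⇓⁻¹ φ e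
  ... | inj₂ (i , eq) = suc i , eq

-- Coefficient vectors of combinations.

module _ (A Γ : FmM → Set) where

  open MLL₀ᵘOrder A Γ

  -- Unlike `linComb`, bracketed to the right and ending in `𝟘`, which allows the empty vector and
  -- plain recursion.
  sumComb : ∀ {n} → Vec ℕ n → Vec FmM n → FmM
  sumComb []       []       = 𝟘
  sumComb (l ∷ λs) (φ ∷ φs) = mul l φ ⊞ sumComb λs φs

  sumComb-⊞ : ∀ {n} (λs μs : Vec ℕ n) (φs : Vec FmM n) →
    sumComb λs φs ⊞ sumComb μs φs ≼ sumComb (zipWith _+_ λs μs) φs
  sumComb-⊞ [] [] [] = ⊞-𝟘ˡ
  sumComb-⊞ (l ∷ λs) (m ∷ μs) (φ ∷ φs) = ⊞-interchange ⟫ ⊞-mono (mul-+ l m) (sumComb-⊞ λs μs φs)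

  𝟘≼sumComb : ∀ {n} (φs : Vec FmM n) → 𝟘 ≼ sumComb (replicate n 0) φs
  𝟘≼sumComb []       = ≼-refl
  𝟘≼sumComb (φ ∷ φs) = ⊞-𝟘ˡ⁻ ⟫ ⊞-monoʳ (𝟘≼sumComb φs)

  lookup≼sumComb : ∀ {n} (φs : Vec FmM n) i →
    ∃ λ λs → lookup λs i ≢ 0 × lookup φs i ≼ sumComb λs φs
  lookup≼sumComb (φ ∷ φs) zero = 1 ∷ replicate _ 0 , (λ ()) , (⊞-𝟘ʳ⁻ ⟫ ⊞-mono ⊞-𝟘ˡ⁻ (𝟘≼sumComb φs))
  lookup≼sumComb (φ ∷ φs) (suc i) with lookup≼sumComb φs i
  ... | λs , λᵢ≢0 , p = 0 ∷ λs , λᵢ≢0 , (p ⟫ ⊞-𝟘ˡ⁻)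

  -- Coefficients add up along `⊕`, and a nonzero entry of the left part survives because natural
  -- numbers do not cancel.
  combination≼sumComb : ∀ {n χ} (φs : Vec FmM n) → Combination (λ φ → ∃ λ i → φ ≡ lookup φs i) χ →
    ∃ λ λs → (∃ λ i → lookup λs i ≢ 0) × χ ≼ sumComb λs φs
  combination≼sumComb φs (base (i , refl)) with lookup≼sumComb φs i
  ... | λs , λᵢ≢0 , p = λs , (i , λᵢ≢0) , p
  combination≼sumComb φs (c ⊕ d) with combination≼sumComb φs c | combination≼sumComb φs d
  ... | λs , (i , λᵢ≢0) , p | μs , _ , q =
    zipWith _+_ λs μs ,
    (i , λ eq → λᵢ≢0 (m+n≡0⇒m≡0 _ (trans (sym (lookup-zipWith _+_ i λs μs)) eq))) ,
    (⊞-mono p q ⟫ sumComb-⊞ λs μs φs)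

  ⊞-sumComb≼foldl : ∀ {n} χ (λs : Vec ℕ n) (φs : Vec FmM n) →
    χ ⊞ sumComb λs φs ≼ foldl (λ _ → FmM) _⊞_ χ (zipWith mul λs φs)
  ⊞-sumComb≼foldl χ []       []       = ⊞-𝟘ʳ
  ⊞-sumComb≼foldl χ (l ∷ λs) (φ ∷ φs) = ⊞-assocˡ ⟫ ⊞-sumComb≼foldl (χ ⊞ mul l φ) λs φs

  sumComb≼linComb : ∀ {n} (λs : Vec ℕ (suc n)) (φs : Vec FmM (suc n)) → sumComb λs φs ≼ linComb λs φs
  sumComb≼linComb (l ∷ λs) (φ ∷ φs) = ⊞-sumComb≼foldl (mul l φ) λs φs

-- Collapsing the trees.

module _ (A : FmM → Set) (h : Hyp A) where

  open Split A h

  cover⇒alternatives : ∀ {P Γ Δ} → Cover (λ Δ → Alternatives A P (Γ ∪ Δ)) Δ → Alternatives A P (Γ ∪ Δ)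
  cover⇒alternatives (leaf x)       = x
  cover⇒alternatives (branch ψ c d) = split ψ (cover⇒alternatives c) (cover⇒alternatives d)

  -- On each leaf the disjunction takes the value of some `lookup φs i`, a combination with one
  -- summand. Concluding in MLL₀ᵘ lets it serve both halves of the theorem.
  bigOr⇒linComb : ∀ Γ {n} (φs : Vec FmM (suc n)) → ιSet Γ ⊢IUL⋆[ A ] bigOr (map ι φs) →
    ∃ λ λs → (∃ λ i → lookup λs i ≢ 0) × Γ ⊢MLL₀ᵘ[ A ] linComb λs φs
  bigOr⇒linComb Γ φs d with cover⇒alternatives
    (soundness {Δ = []} d >>= λ { _ (a , e , p) → leaf (a , base (bigOr⇓ φs e) , p) })
    where open Evaluation A Γ
  ... | χ , c , p with combination≼sumComb A Γ φs c
  ... | λs , λs≢0 , q = λs , λs≢0 ,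
    mp (mp (weaken (λ { (inj₁ γ) → γ }) p) q) (sumComb≼linComb A Γ λs φs)

theorem3p4 : (A : FmM → Set) → Hyp A → TheoremOfAlternatives A × MultFragmentIsMLL₀ᵘ A
theorem3p4 A h = alternatives , fragment
  where
  alternatives : TheoremOfAlternatives A
  alternatives Γ n φs = mk⇔
    (λ d → let λs , λs≢0 , e = bigOr⇒linComb A h Γ φs d in λs , λs≢0 , MLL₀ᵘ⇒IUL⋆ e)
    (λ { (λs , (i , λᵢ≢0) , d) → linComb⇒bigOr λs φs i λᵢ≢0 d })

  cancel : ∀ {Γ φ} → (∃ λ λs → (∃ λ i → lookup λs i ≢ 0) × Γ ⊢MLL₀ᵘ[ A ] linComb λs (φ ∷ [])) →
    Γ ⊢MLL₀ᵘ[ A ] φ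
  cancel (zero  ∷ [] , (zero , λ₀≢0) , d) = ⊥-elim (λ₀≢0 refl)
  cancel (suc n ∷ [] , _             , d) = urule n d

  fragment : MultFragmentIsMLL₀ᵘ A
  -- For a single formula `bigOr` is `ι φ` itself, and `urule` removes the nonzero coefficient.
  fragment Γ φ = mk⇔ (λ d → cancel (bigOr⇒linComb A h Γ (φ ∷ []) d)) MLL₀ᵘ⇒IUL⋆
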